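{- There is no deterministic online algorithm with competitive ratio $o(n)$ for the degree-bounded group Steiner tree problem, where $n$ is the number of vertices. That is, for every deterministic online algorithm $\mathcal{A}$ and every function $f$ with $f(n)=o(n)$, there exist an instance on some number $n$ of vertices and a sequence of demand groups such that the maximum degree of $\mathcal{A}$'s final subgraph exceeds $f(n)\cdot\mathrm{OPT}$.
   Context: Online degree-bounded group Steiner tree: an undirected graph $G$ with a root vertex is given in advance; demands are subsets (groups) of vertices arriving one by one, and after each arrival the online algorithm must add edges (never removing any) so that for every group seen so far, at least one vertex of the group is connected to the root. The objective is to minimize the maximum vertex degree of the final subgraph; $\mathrm{OPT}$ is the minimum maximum degree of a subgraph in which every demand group has a vertex connected to the root. The competitive ratio is the worst-case ratio of the algorithm's maximum degree to $\mathrm{OPT}$. -}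

module Defs where

open import Data.Fin using (Fin)
open import Data.Fin.Subset using (Subset; _∈_; _∉_; _⊆_; ∣_∣; Empty)
open import Data.Integer using (+_)
open import Data.List using (List; []; _∷_; tabulate)
open import Data.List.Extrema.Nat using (max)
open import Data.List.Relation.Unary.All using (All)
open import Data.Nat as ℕ using (ℕ)
open import Data.Product using (∃; _×_)
open import Data.Rational as ℚ using (ℚ; 0ℚ; _/_)
open import Relation.Binary.Construct.Closure.ReflexiveTransitive using (Star)
open import Relation.Binary.PropositionalEquality using (_≡_)

-- Finite simple undirected graphs on the vertex set Fin n.
record Graph (n : ℕ) : Set where
  field
    neighbours : Fin n → Subset n
    symmetric  : ∀ {u v} → v ∈ neighbours u → u ∈ neighbours v
    loopless   : ∀ {v} → v ∉ neighbours v

open Graph public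

degree : ∀ {n} → Graph n → Fin n → ℕ
degree G v = ∣ neighbours G v ∣

maxDegree : ∀ {n} → Graph n → ℕ
maxDegree G = max 0 (tabulate (degree G))

-- Subgraphs are taken to be spanning (isolated vertices change neither degrees
-- nor connections to the root), so a subgraph is just a set of edges.
_⊑_ : ∀ {n} → Graph n → Graph n → Set
H ⊑ G = ∀ v → neighbours H v ⊆ neighbours G v

Edgeless : ∀ {n} → Graph n → Set
Edgeless H = ∀ v → Empty (neighbours H v)

Connected : ∀ {n} → Graph n → Fin n → Fin n → Set
Connected G = Star (λ u v → v ∈ neighbours G u)

record RootedGraph (n : ℕ) : Set where
  field
    graph : Graph n
    root  : Fin n

open RootedGraph public

-- A sequence of demand groups, the most recently arrived group first.
Demands : ℕ → Set
Demands n = List (Subset n)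

Serves : ∀ {n} → Graph n → Fin n → Demands n → Set
Serves H r = All (λ g → ∃ λ v → v ∈ g × Connected H r v)

IsSolution : ∀ {n} → RootedGraph n → Demands n → Graph n → Set
IsSolution I gs H = H ⊑ graph I × Serves H (root I) gs

-- Demands that can be met at all, i.e. by buying every edge.
Feasible : ∀ {n} → RootedGraph n → Demands n → Set
Feasible I gs = Serves (graph I) (root I) gs

record IsOPT {n : ℕ} (I : RootedGraph n) (gs : Demands n) (opt : ℕ) : Set where
  field
    attained : ∃ λ H → IsSolution I gs H × maxDegree H ≡ opt
    minimal  : ∀ H → IsSolution I gs H → opt ℕ.≤ maxDegree H

-- A deterministic online algorithm: its current subgraph is a function of the
-- rooted graph (known in advance) and the groups that have arrived so far.
-- Nothing is asked of it on demand sequences that no subgraph can serve.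
record OnlineAlgorithm : Set where
  field
    output   : ∀ {n} → RootedGraph n → Demands n → Graph n
    start    : ∀ {n} (I : RootedGraph n) → Edgeless (output I [])
    monotone : ∀ {n} (I : RootedGraph n) g gs → Feasible I (g ∷ gs) →
               output I gs ⊑ output I (g ∷ gs)
    correct  : ∀ {n} (I : RootedGraph n) gs → Feasible I gs →
               IsSolution I gs (output I gs)

open OnlineAlgorithm public

fromℕ : ℕ → ℚ
fromℕ k = + k / 1

-- f(n) = o(n)
Sublinear : (ℕ → ℚ) → Set
Sublinear f = ∀ ε → 0ℚ ℚ.< ε →
  ∃ λ N → ∀ n → N ℕ.≤ n → ℚ.∣ f n ∣ ℚ.≤ ε ℚ.* fromℕ n

{-# OPTIONS --safe #-}

-- On a star rooted at its centre the adversary keeps demanding the group of all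
-- leaves not yet joined to the root.  Each demand forces a new edge at the root,
-- so the algorithm ends up buying the whole star.  The demanded groups are nested,
-- so a single edge to a leaf of the last group serves them all and OPT = 1, while the
-- root ends up with degree n − 1, which exceeds f(n) ≤ n/2 for large n.
module Submission where

open import Data.Bool using (true)
open import Data.Fin using (Fin; zero)
open import Data.Fin.Properties using () renaming (_≟_ to _≟ᶠ_)
open import Data.Fin.Subset
  using (Subset; _∈_; _∉_; _⊆_; _⊂_; Nonempty; Empty; ∁; _∩_; ⁅_⁆)
  renaming (∣_∣ to size)
open import Data.Fin.Subset.Induction using (Acc; acc; ⊂-wellFounded)
open import Data.Fin.Subset.Properties
  using (_∈?_; x∈⁅x⁆; x∈⁅y⁆⇒x≡y; x≢y⇒x∉⁅y⁆; ∣⁅x⁆∣≡1; ∣⊥∣≡0; ∣∁p∣≡n∸∣p∣;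
    nonempty?; Empty-unique; ⊆-trans; p⊆q⇒∣p∣≤∣q∣; p∩q⊆p; p∩q⊆q; x∈p∩q⁺; x∈p∩q⁻;
    x∈p⇒x∉∁p; x∈∁p⇒x∉p; x∉∁p⇒x∈p; x∉p⇒x∈∁p)
open import Data.Integer as ℤ using (+_)
import Data.Integer.Properties as ℤ
open import Data.List using ([]; _∷_)
open import Data.List.Extrema.Nat using (max≤v⁺; xs≤max)
open import Data.List.Relation.Unary.All as All using (All; []; _∷_)
import Data.List.Relation.Unary.All.Properties as All
open import Data.List.Relation.Unary.Any using (Any; here; there)
open import Data.Nat as ℕ using (ℕ; suc; z≤n; s≤s; _⊔_; _∸_)
import Data.Nat.Properties as ℕ
open import Data.Product using (Σ-syntax; ∃; _×_; _,_; proj₁)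
open import Data.Rational using (ℚ; _*_; _/_; _<_; _≤_; *<*; *≤*; 0ℚ; 1ℚ; ½; ∣_∣)
open import Data.Rational.Literals using (fromℤ)
import Data.Rational.Properties as ℚ
open import Data.Sum as Sum using (_⊎_; inj₁; inj₂; fromInj₂)
open import Data.Vec using (tabulate)
open import Data.Vec.Properties using ([]=⇒lookup; lookup⇒[]=; lookup∘tabulate)
open import Function using (_∘_; case_of_; id)
open import Level using (0ℓ)
open import Relation.Binary using (Rel; Symmetric) renaming (Decidable to Decidable₂)
open import Relation.Binary.Construct.Closure.ReflexiveTransitive using (ε; _◅_)
open import Relation.Binary.PropositionalEquality
  using (_≡_; _≢_; refl; sym; trans; cong; subst)
open import Relation.Nullary using (Dec; ¬_; does; proof; yes; no; contradiction)
open import Relation.Nullary.Decidable using (dec-true; _×-dec_; _⊎-dec_)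
open import Relation.Nullary.Reflects using (Reflects; invert)
open import Relation.Unary using (Pred; Decidable)
open import Defs

private
  variable
    n : ℕ
    u v r : Fin n
    p : Subset n
    G H : Graph n
    gs : Demands n

subsetOf : {P : Pred (Fin n) 0ℓ} → Decidable P → Subset n
subsetOf P? = tabulate (does ∘ P?)

module _ {P : Pred (Fin n) 0ℓ} (P? : Decidable P) where

  ∈-subsetOf⁺ : P v → v ∈ subsetOf P?
  ∈-subsetOf⁺ {v} Pv =
    lookup⇒[]= v _ (trans (lookup∘tabulate (does ∘ P?) v) (dec-true (P? v) Pv))

  ∈-subsetOf⁻ : v ∈ subsetOf P? → P v
  ∈-subsetOf⁻ {v} v∈ = invert (subst (Reflects (P v)) does≡true (proof (P? v)))
    where
    does≡true : does (P? v) ≡ true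
    does≡true = trans (sym (lookup∘tabulate (does ∘ P?) v)) ([]=⇒lookup v∈)

x∈p⇒1≤∣p∣ : v ∈ p → 1 ℕ.≤ size p
x∈p⇒1≤∣p∣ {v = v} {p} v∈p = begin
  1           ≡⟨ ∣⁅x⁆∣≡1 v ⟨
  size ⁅ v ⁆  ≤⟨ p⊆q⇒∣p∣≤∣q∣ (λ x∈⁅v⁆ → subst (_∈ p) (sym (x∈⁅y⁆⇒x≡y v x∈⁅v⁆)) v∈p) ⟩
  size p      ∎
  where open ℕ.≤-Reasoning

1≤∣p∣⇒nonempty : (p : Subset n) → 1 ℕ.≤ size p → Nonempty p
1≤∣p∣⇒nonempty {n} p 1≤∣p∣ with nonempty? p
... | yes nonempty = nonempty
... | no  empty    = contradiction 1≤∣p∣ (ℕ.<⇒≱ (ℕ.≤-reflexive (cong suc ∣p∣≡0)))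
  where
  ∣p∣≡0 : size p ≡ 0
  ∣p∣≡0 = trans (cong size (Empty-unique empty)) (∣⊥∣≡0 n)

relationGraph : {R : Rel (Fin n) 0ℓ} →
  Decidable₂ R → Symmetric R → (∀ {v} → ¬ R v v) → Graph n
relationGraph R? R-sym R-irrefl = record
  { neighbours = λ u → subsetOf (R? u)
  ; symmetric  = λ {u} {v} v∈ → ∈-subsetOf⁺ (R? v) (R-sym (∈-subsetOf⁻ (R? u) v∈))
  ; loopless   = λ {v} v∈ → R-irrefl (∈-subsetOf⁻ (R? v) v∈)
  }

adjacent⇒≢ : (G : Graph n) → v ∈ neighbours G u → v ≢ u
adjacent⇒≢ G v∈N refl = loopless G v∈N

degree≤maxDegree : (G : Graph n) → ∀ v → degree G v ℕ.≤ maxDegree G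
degree≤maxDegree G = All.tabulate⁻ (xs≤max 0 _)

maxDegree≤ : ∀ {k} (G : Graph n) → (∀ v → degree G v ℕ.≤ k) → maxDegree G ℕ.≤ k
maxDegree≤ G bound = max≤v⁺ z≤n (All.tabulate⁺ bound)

connected-≢⇒1≤degree : (H : Graph n) → Connected H r v → v ≢ r → 1 ℕ.≤ degree H r
connected-≢⇒1≤degree H ε         v≢r = contradiction refl v≢r
connected-≢⇒1≤degree H (u∈N ◅ _) _   = x∈p⇒1≤∣p∣ u∈N

serves⇒1≤maxDegree : (H : Graph n) → Any (r ∉_) gs → Serves H r gs → 1 ℕ.≤ maxDegree H
serves⇒1≤maxDegree {r = r} H (here r∉g) ((v , v∈g , path) ∷ _) =
  ℕ.≤-trans (connected-≢⇒1≤degree H path (λ v≡r → r∉g (subst (_∈ _) v≡r v∈g)))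
            (degree≤maxDegree H r)
serves⇒1≤maxDegree H (there r∉) (_ ∷ serves) = serves⇒1≤maxDegree H r∉ serves

adjacent-serves : v ∈ neighbours H r → All (v ∈_) gs → Serves H r gs
adjacent-serves v∈N = All.map (λ v∈g → _ , v∈g , v∈N ◅ ε)

StarAdjacent : Fin n → Subset n → Rel (Fin n) 0ℓ
StarAdjacent c L u v = u ≡ c × v ∈ L ⊎ v ≡ c × u ∈ L

starAdjacent? : (c : Fin n) (L : Subset n) → Decidable₂ (StarAdjacent c L)
starAdjacent? c L u v = (u ≟ᶠ c ×-dec v ∈? L) ⊎-dec (v ≟ᶠ c ×-dec u ∈? L)

star : {c : Fin n} {L : Subset n} → c ∉ L → Graph n
star {c = c} {L} c∉L = relationGraph (starAdjacent? c L) Sum.swap λ where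
  (inj₁ (refl , c∈L)) → c∉L c∈L
  (inj₂ (refl , c∈L)) → c∉L c∈L

module _ {c : Fin n} {L : Subset n} (c∉L : c ∉ L) where

  ∈-star⁺ : ∀ u → StarAdjacent c L u v → v ∈ neighbours (star c∉L) u
  ∈-star⁺ u = ∈-subsetOf⁺ (starAdjacent? c L u)

  ∈-star⁻ : ∀ u → v ∈ neighbours (star c∉L) u → StarAdjacent c L u v
  ∈-star⁻ u = ∈-subsetOf⁻ (starAdjacent? c L u)

  leaf∈star : v ∈ L → v ∈ neighbours (star c∉L) c
  leaf∈star v∈L = ∈-star⁺ c (inj₁ (refl , v∈L))

  star⊑ : L ⊆ neighbours G c → star c∉L ⊑ G
  star⊑ {G = G} L⊆N u v∈ with ∈-star⁻ u v∈
  ... | inj₁ (refl , v∈L) = L⊆N v∈L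
  ... | inj₂ (refl , u∈L) = symmetric G (L⊆N u∈L)

  maxDegree-star≤ : maxDegree (star c∉L) ℕ.≤ size L ⊔ 1
  maxDegree-star≤ = maxDegree≤ (star c∉L) λ u → degree≤ u (u ≟ᶠ c)
    where
    open ℕ.≤-Reasoning

    neighbours-centre : neighbours (star c∉L) c ⊆ L
    neighbours-centre v∈ with ∈-star⁻ c v∈
    ... | inj₁ (_ , v∈L) = v∈L
    ... | inj₂ (_ , c∈L) = contradiction c∈L c∉L

    neighbours-leaf : ∀ u → u ≢ c → neighbours (star c∉L) u ⊆ ⁅ c ⁆
    neighbours-leaf u u≢c v∈ with ∈-star⁻ u v∈
    ... | inj₁ (u≡c , _)  = contradiction u≡c u≢c
    ... | inj₂ (refl , _) = x∈⁅x⁆ c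

    degree≤ : ∀ u → Dec (u ≡ c) → degree (star c∉L) u ℕ.≤ size L ⊔ 1
    degree≤ u (yes refl) = begin
      degree (star c∉L) c  ≤⟨ p⊆q⇒∣p∣≤∣q∣ neighbours-centre ⟩
      size L               ≤⟨ ℕ.m≤m⊔n (size L) 1 ⟩
      size L ⊔ 1           ∎
    degree≤ u (no u≢c) = begin
      degree (star c∉L) u  ≤⟨ p⊆q⇒∣p∣≤∣q∣ (neighbours-leaf u u≢c) ⟩
      size ⁅ c ⁆           ≡⟨ ∣⁅x⁆∣≡1 c ⟩
      1                    ≤⟨ ℕ.m≤n⊔m (size L) 1 ⟩
      size L ⊔ 1           ∎

commonNeighbour⇒isOPT-1 : (I : RootedGraph n) → v ∈ neighbours (graph I) (root I) →
  All (v ∈_) gs → Any (root I ∉_) gs → IsOPT I gs 1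
commonNeighbour⇒isOPT-1 {v = v} {gs} I v∈N v∈gs root∉ = record
  { attained = edge , edge-solves , ℕ.≤-antisym maxDegree-edge≤1 (atLeast1 edge edge-solves)
  ; minimal  = atLeast1
  }
  where
  root∉⁅v⁆ : root I ∉ ⁅ v ⁆
  root∉⁅v⁆ = x≢y⇒x∉⁅y⁆ (adjacent⇒≢ (graph I) v∈N ∘ sym)

  edge : Graph _
  edge = star root∉⁅v⁆

  atLeast1 : ∀ H → IsSolution I gs H → 1 ℕ.≤ maxDegree H
  atLeast1 H (_ , serves) = serves⇒1≤maxDegree H root∉ serves

  ⁅v⁆⊆N : ⁅ v ⁆ ⊆ neighbours (graph I) (root I)
  ⁅v⁆⊆N x∈ = subst (_∈ neighbours (graph I) (root I)) (sym (x∈⁅y⁆⇒x≡y v x∈)) v∈N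

  edge-solves : IsSolution I gs edge
  edge-solves = star⊑ root∉⁅v⁆ {G = graph I} ⁅v⁆⊆N
              , adjacent-serves {H = edge} (leaf∈star root∉⁅v⁆ (x∈⁅x⁆ v)) v∈gs

  maxDegree-edge≤1 : maxDegree edge ℕ.≤ 1
  maxDegree-edge≤1 =
    subst (λ k → maxDegree edge ℕ.≤ k ⊔ 1) (∣⁅x⁆∣≡1 v) (maxDegree-star≤ root∉⁅v⁆)

EdgesMeetRoot : RootedGraph n → Set
EdgesMeetRoot I = ∀ {u v} → v ∈ neighbours (graph I) u → u ≡ root I ⊎ v ≡ root I

connected⇒adjacent : (I : RootedGraph n) → EdgesMeetRoot I → (H : Graph n) → H ⊑ graph I →
  v ≢ root I → Connected H (root I) v → v ∈ neighbours H (root I)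
connected⇒adjacent I edgesMeetRoot H H⊑G v≢r path =
  fromInj₂ (λ v≡r → contradiction v≡r v≢r) (reached path (inj₁ refl))
  where
  reached : Connected H u v → u ≡ root I ⊎ u ∈ neighbours H (root I) →
    v ≡ root I ⊎ v ∈ neighbours H (root I)
  reached ε          reached-u = reached-u
  reached (e ◅ path) _ with edgesMeetRoot (H⊑G _ e)
  ... | inj₁ refl = reached path (inj₂ e)
  ... | inj₂ w≡r  = reached path (inj₁ w≡r)

ForcesDegree : OnlineAlgorithm → RootedGraph n → ℕ → Set
ForcesDegree A I k = ∃ λ gs →
  Feasible I gs × IsOPT I gs 1 × k ℕ.≤ maxDegree (output A I gs)

module Adversary
  (A : OnlineAlgorithm) (I : RootedGraph n) (edgesMeetRoot : EdgesMeetRoot I) where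

  rootNeighbours : Subset n
  rootNeighbours = neighbours (graph I) (root I)

  bought : Demands n → Subset n
  bought gs = neighbours (output A I gs) (root I)

  unbought : Demands n → Subset n
  unbought gs = rootNeighbours ∩ ∁ (bought gs)

  demandUnbought : Demands n → Demands n
  demandUnbought gs = unbought gs ∷ gs

  unbought⊆rootNeighbours : unbought gs ⊆ rootNeighbours
  unbought⊆rootNeighbours {gs} = p∩q⊆p rootNeighbours (∁ (bought gs))

  unbought-shrinks : ∀ gs → Feasible I (demandUnbought gs) →
    unbought (demandUnbought gs) ⊂ unbought gs
  unbought-shrinks gs feasible = shrunk , newly-bought
    where
    shrunk : unbought (demandUnbought gs) ⊆ unbought gs
    shrunk x∈ with x∈p∩q⁻ rootNeighbours _ x∈
    ... | x∈N , x∈∁ =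
      x∈p∩q⁺ (x∈N , x∉p⇒x∈∁p (x∈∁p⇒x∉p x∈∁ ∘ monotone A I (unbought gs) gs feasible (root I)))

    newly-bought : ∃ λ v → v ∈ unbought gs × v ∉ unbought (demandUnbought gs)
    newly-bought with correct A I (demandUnbought gs) feasible
    ... | H⊑G , (v , v∈unbought , path) ∷ _ =
      v , v∈unbought , λ v∈unbought′ →
        x∈p⇒x∉∁p v∈bought (p∩q⊆q rootNeighbours (∁ (bought (demandUnbought gs))) v∈unbought′)
      where
      v∈bought : v ∈ bought (demandUnbought gs)
      v∈bought = connected⇒adjacent I edgesMeetRoot (output A I (demandUnbought gs)) H⊑G
        (adjacent⇒≢ (graph I) (unbought⊆rootNeighbours {gs} v∈unbought)) path

  exhausted⇒degree≤ : Empty (unbought gs) →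
    degree (graph I) (root I) ℕ.≤ maxDegree (output A I gs)
  exhausted⇒degree≤ {gs} empty = begin
    size rootNeighbours        ≤⟨ p⊆q⇒∣p∣≤∣q∣ all-bought ⟩
    size (bought gs)           ≤⟨ degree≤maxDegree (output A I gs) (root I) ⟩
    maxDegree (output A I gs)  ∎
    where
    open ℕ.≤-Reasoning
    all-bought : rootNeighbours ⊆ bought gs
    all-bought v∈N = x∉∁p⇒x∈p (λ v∈∁ → empty (_ , x∈p∩q⁺ (v∈N , v∈∁)))

  forcesDegree-from : ∀ gs → Acc _⊂_ (unbought gs) → Nonempty (unbought gs) →
    All (unbought gs ⊆_) gs → ForcesDegree A I (degree (graph I) (root I))
  forcesDegree-from gs (acc rec) (v , v∈unbought) nested =
    next-round (nonempty? (unbought gs′))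
    where
    gs′ : Demands n
    gs′ = demandUnbought gs

    nested′ : All (unbought gs ⊆_) gs′
    nested′ = id ∷ nested

    v∈N : v ∈ rootNeighbours
    v∈N = unbought⊆rootNeighbours {gs} v∈unbought

    v∈gs′ : All (v ∈_) gs′
    v∈gs′ = All.map (λ unbought⊆g → unbought⊆g v∈unbought) nested′

    feasible : Feasible I gs′
    feasible = adjacent-serves {H = graph I} v∈N v∈gs′

    root∉unbought : root I ∉ unbought gs
    root∉unbought = loopless (graph I) ∘ unbought⊆rootNeighbours {gs}

    next-round : Dec (Nonempty (unbought gs′)) → ForcesDegree A I (degree (graph I) (root I))
    next-round (yes nonempty) = forcesDegree-from gs′ (rec shrinks) nonempty
        (All.map (⊆-trans (proj₁ shrinks)) nested′)
      where
      shrinks : unbought gs′ ⊂ unbought gs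
      shrinks = unbought-shrinks gs feasible
    next-round (no empty) =
      gs′ , feasible , commonNeighbour⇒isOPT-1 I v∈N v∈gs′ (here root∉unbought) ,
      exhausted⇒degree≤ {gs′} empty

  forcesDegree-root : 1 ℕ.≤ degree (graph I) (root I) →
    ForcesDegree A I (degree (graph I) (root I))
  forcesDegree-root 1≤degree with 1≤∣p∣⇒nonempty rootNeighbours 1≤degree
  ... | v , v∈N = forcesDegree-from [] (⊂-wellFounded _) (v , v∈unbought) []
    where
    v∈unbought : v ∈ unbought []
    v∈unbought = x∈p∩q⁺ (v∈N , x∉p⇒x∈∁p λ v∈bought → start A I (root I) (v , v∈bought))

c∉∁⁅c⁆ : (c : Fin n) → c ∉ ∁ ⁅ c ⁆
c∉∁⁅c⁆ c = x∈p⇒x∉∁p (x∈⁅x⁆ c)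

spanningStar : Fin n → RootedGraph n
spanningStar c = record { graph = star (c∉∁⁅c⁆ c) ; root = c }

spanningStar-edgesMeetRoot : (c : Fin n) → EdgesMeetRoot (spanningStar c)
spanningStar-edgesMeetRoot c {u} v∈ = Sum.map proj₁ proj₁ (∈-star⁻ (c∉∁⁅c⁆ c) u v∈)

spanningStar-degree : (c : Fin n) → n ∸ 1 ℕ.≤ degree (graph (spanningStar c)) c
spanningStar-degree {n} c = begin
  n ∸ 1                              ≡⟨ cong (n ∸_) (∣⁅x⁆∣≡1 c) ⟨
  n ∸ size ⁅ c ⁆                     ≡⟨ ∣∁p∣≡n∸∣p∣ ⁅ c ⁆ ⟨
  size (∁ ⁅ c ⁆)                     ≤⟨ p⊆q⇒∣p∣≤∣q∣ (leaf∈star (c∉∁⁅c⁆ c)) ⟩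
  degree (graph (spanningStar c)) c  ∎
  where open ℕ.≤-Reasoning

spanningStar-forcesDegree : (A : OnlineAlgorithm) (c : Fin n) → 1 ℕ.≤ n ∸ 1 →
  ForcesDegree A (spanningStar c) (n ∸ 1)
spanningStar-forcesDegree A c 1≤n-1 =
  let n-1≤degree = spanningStar-degree c
      gs , feasible , isOPT , degree≤maxDegree =
        Adversary.forcesDegree-root A (spanningStar c) (spanningStar-edgesMeetRoot c)
          (ℕ.≤-trans 1≤n-1 n-1≤degree)
  in gs , feasible , isOPT , ℕ.≤-trans n-1≤degree degree≤maxDegree

p≤∣p∣ : ∀ p → p ≤ ∣ p ∣
p≤∣p∣ p with ℚ.≤-total 0ℚ p
... | inj₁ 0≤p = ℚ.≤-reflexive (sym (ℚ.0≤p⇒∣p∣≡p 0≤p))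
... | inj₂ p≤0 = ℚ.≤-trans p≤0 (ℚ.0≤∣p∣ p)

fromℕ≡fromℤ : ∀ k → fromℕ k ≡ fromℤ (+ k)
fromℕ≡fromℤ k = ℚ.↥p/↧p≡p (fromℤ (+ k))

fromℕ-mono-≤ : ∀ {j k} → j ℕ.≤ k → fromℕ j ≤ fromℕ k
fromℕ-mono-≤ {j} {k} j≤k rewrite fromℕ≡fromℤ j | fromℕ≡fromℤ k =
  *≤* (ℤ.*-monoʳ-≤-nonNeg (+ 1) (ℤ.+≤+ j≤k))

fromℕ-mono-< : ∀ {j k} → j ℕ.< k → fromℕ j < fromℕ k
fromℕ-mono-< {j} {k} j<k rewrite fromℕ≡fromℤ j | fromℕ≡fromℤ k =
  *<* (ℤ.*-monoʳ-<-pos (+ 1) (ℤ.+<+ j<k))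

fromℕ-homo-* : ∀ j k → fromℕ (j ℕ.* k) ≡ fromℕ j * fromℕ k
fromℕ-homo-* j k rewrite fromℕ≡fromℤ j | fromℕ≡fromℤ k = cong (_/ 1) (ℤ.pos-* j k)

sublinear⇒f[1+m]<m : ∀ {f} → Sublinear f → ∀ k → ∃ λ m → k ℕ.≤ m × f (suc m) < fromℕ m
sublinear⇒f[1+m]<m {f} sublinear k with sublinear ½ (ℚ.positive⁻¹ ½)
... | N , ∣f∣≤n/2 =
  m , ℕ.m≤n⇒m≤o+n 2 (ℕ.m≤m+n k N) , f[1+m]<m m (s≤s (s≤s z≤n)) (ℕ.m≤n⇒m≤o+n 3 (ℕ.m≤n+m N k))
  where
  m : ℕ
  m = 2 ℕ.+ (k ℕ.+ N)

  open ℚ.≤-Reasoning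

  1+m<2m : ∀ {m} → 1 ℕ.< m → suc m ℕ.< 2 ℕ.* m
  1+m<2m {m} 1<m rewrite ℕ.+-identityʳ m = ℕ.+-monoˡ-< m 1<m

  f[1+m]<m : ∀ m → 1 ℕ.< m → N ℕ.≤ suc m → f (suc m) < fromℕ m
  f[1+m]<m m 1<m N≤1+m = begin-strict
    f (suc m)               ≤⟨ p≤∣p∣ (f (suc m)) ⟩
    ∣ f (suc m) ∣           ≤⟨ ∣f∣≤n/2 (suc m) N≤1+m ⟩
    ½ * fromℕ (suc m)       <⟨ ℚ.*-monoʳ-<-pos ½ (fromℕ-mono-< (1+m<2m 1<m)) ⟩
    ½ * fromℕ (2 ℕ.* m)     ≡⟨ cong (½ *_) (fromℕ-homo-* 2 m) ⟩
    ½ * (fromℕ 2 * fromℕ m) ≡⟨ ℚ.*-assoc ½ (fromℕ 2) (fromℕ m) ⟨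
    1ℚ * fromℕ m            ≡⟨ ℚ.*-identityˡ (fromℕ m) ⟩
    fromℕ m                 ∎

forcesDegree⇒exceedsRatio : (A : OnlineAlgorithm) (I : RootedGraph n) → ∀ {k q} →
  ForcesDegree A I k → q < fromℕ k →
  Σ[ gs ∈ Demands n ] Σ[ opt ∈ ℕ ]
    Feasible I gs × IsOPT I gs opt × q * fromℕ opt < fromℕ (maxDegree (output A I gs))
forcesDegree⇒exceedsRatio A I {k} {q} (gs , feasible , isOPT , k≤maxDegree) q<k =
  gs , 1 , feasible , isOPT , exceeds (maxDegree (output A I gs)) k≤maxDegree
  where
  exceeds : ∀ d → k ℕ.≤ d → q * fromℕ 1 < fromℕ d
  exceeds d k≤d = begin-strict
    q * fromℕ 1  ≡⟨ ℚ.*-identityʳ q ⟩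
    q            <⟨ q<k ⟩
    fromℕ k      ≤⟨ fromℕ-mono-≤ k≤d ⟩
    fromℕ d      ∎
    where open ℚ.≤-Reasoning

theorem4 : (A : OnlineAlgorithm) (f : ℕ → ℚ) → Sublinear f →
    Σ[ n ∈ ℕ ] Σ[ I ∈ RootedGraph n ] Σ[ gs ∈ Demands n ] Σ[ opt ∈ ℕ ]
      Feasible I gs × IsOPT I gs opt ×
      f n * fromℕ opt < fromℕ (maxDegree (output A I gs))
theorem4 A f sublinear = case sublinear⇒f[1+m]<m sublinear 1 of λ where
  (m , 1≤m , f[1+m]<m) → suc m , spanningStar zero ,
    forcesDegree⇒exceedsRatio A (spanningStar zero) (spanningStar-forcesDegree A zero 1≤m) f[1+m]<m
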